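{- For every positive integer $n$, \[ \mathcal{M}(n)=\Bigl\lfloor \frac{n^2-4n+6}{11}\Bigr\rfloor . \]
   Context: For $n\in\mathbb{N}=\{1,2,\dots\}$ let $[n]=\{1,\dots,n\}$. A $2$-coloring of $[n]$ is a map $\chi\colon[n]\to\{R,B\}$. For such $\chi$, $\mathcal{M}(n,\chi)$ is the number of triples $(x,y,z)\in[n]^3$ with $z=x+y$ and $\chi(x)=\chi(y)=\chi(z)$ (ordered triples: $(x,y,x+y)$ and $(y,x,x+y)$ are counted separately when $x\neq y$). Define $\mathcal{M}(n)=\min_{\chi\colon[n]\to\{R,B\}}\mathcal{M}(n,\chi)$. -}

module Defs where

open import Data.Nat using (ℕ; zero; suc; _+_; _*_; _∸_; _≤_; _≤?_)
open import Data.Nat.DivMod using (_/_)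
open import Data.Bool using (Bool; true; false; if_then_else_)
open import Data.List using (List; map; upTo)
open import Data.Nat.ListAction using (sum)
open import Data.Vec using (Vec; lookup)
open import Data.Fin using (Fin; fromℕ<)
open import Relation.Nullary using (yes; no)
open import Relation.Binary.PropositionalEquality using (_≡_)
open import Data.Product using (Σ; _×_)

-- A 2-colouring of [n] = {1,…,n}: element i ∈ [n] gets colour  lookup χ (i-1).
-- Colours R/B are encoded as Bool.
Coloring : ℕ → Set
Coloring n = Vec Bool n

-- colour of the integer i (1 ≤ i ≤ n), as a partial function returning a default
-- outside [n] (never used there by the counting below).
col : ∀ {n} → Coloring n → ℕ → Bool
col {n} χ zero = false
col {n} χ (suc i) with suc i ≤? n
... | yes p = lookup χ (fromℕ< p)
... | no _  = false

sameB : Bool → Bool → Bool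
sameB true true = true
sameB false false = true
sameB _ _ = false

mono : ∀ {n} → Coloring n → ℕ → ℕ → ℕ
mono {n} χ x y with x + y ≤? n
... | no _ = 0
... | yes _ = if sameB (col χ x) (col χ y) then (if sameB (col χ y) (col χ (x + y)) then 1 else 0) else 0

range1 : ℕ → List ℕ
range1 n = map suc (upTo n)

Mcount : (n : ℕ) → Coloring n → ℕ
Mcount n χ = sum (map (λ x → sum (map (λ y → mono χ x y) (range1 n))) (range1 n))

IsMinM : ℕ → ℕ → Set
IsMinM n m = Σ (Coloring n) (λ χ → Mcount n χ ≡ m) × ((χ : Coloring n) → m ≤ Mcount n χ)

{-# OPTIONS --safe #-}
module Submission where

-- With εᵢ = ±1 the colour of i, S = Σ εᵢ and T = Σ_{x+y≤n} εₓε_y, the number M of monochromatic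
-- triples satisfies 8M = n² − n + 2(S² − n) + 2T.  Pair i with n+1−i: an equally coloured
-- pair is a step ±1 of a walk in the direction P, an oppositely coloured pair a step ±1 in the
-- direction Q (a central element, for odd n, contributes its sign c alone).  If H and V steps
-- are made in the two directions then n = 2(H + V) + c², S = 2P + c, |P| ≤ H, |Q| ≤ V, and since
-- each pair of a P-step and a Q-step contributes at most 1 to the signed area of the walk,
-- T ≥ 2(P + c)(P + Q) − 2HV − H + V.  Completing squares yields 11M ≥ n² − 4n − 4.
-- Colouring blocks of lengths about 4n/11, 6n/11, n/11 alternately gives equality up to rounding.

open import Defs
open import Data.Bool using (Bool; true; false; not; if_then_else_)
open import Data.Fin using (toℕ; fromℕ<)
open import Data.Fin.Properties using (toℕ-fromℕ<)
open import Data.List using (map; applyUpTo)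
open import Data.List.Properties using (map-cong; map-upTo; map-applyUpTo)
open import Data.Maybe using (Maybe; just; nothing; maybe)
open import Data.Nat using (ℕ; zero; suc; z≤n; s≤s)
open import Data.Nat.DivMod
  using (_/_; _%_; m<n*o⇒m/o<n; m*n/n≡m; /-monoˡ-≤; m≡m%n+[m/n]*n; m%n<n)
open import Data.Nat.ListAction using (sum)
import Data.Nat as ℕ
import Data.Nat.Properties as ℕ
import Data.Nat.Tactic.RingSolver as ℕ
open import Data.Product using (Σ; _,_; proj₁; proj₂)
open import Data.Sum using (inj₁; inj₂)
open import Data.Vec using (tabulate)
open import Data.Vec.Properties using (lookup∘tabulate)
open import Function using (_∘_; flip)
open import Relation.Nullary using (yes; no; contradiction)
open import Relation.Binary.PropositionalEquality

-- The count of triples as a double sum.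

module Counting where

  open import Data.Nat using (_+_; _≤_; _<_; _≤?_)

  ∑ : ℕ → (ℕ → ℕ) → ℕ
  ∑ n f = sum (applyUpTo f n)

  Mcount-∑ : ∀ n (χ : Coloring n) →
    Mcount n χ ≡ ∑ n λ i → ∑ n λ j → mono χ (suc i) (suc j)
  Mcount-∑ n χ = trans (cong sum (map-cong (λ x → over-range1 (mono χ x)) (range1 n)))
                       (over-range1 _)
    where
    over-range1 : ∀ f → sum (map f (range1 n)) ≡ ∑ n (f ∘ suc)
    over-range1 f = cong sum (trans (cong (map f) (map-upTo suc n)) (map-applyUpTo suc f n))

  mono-inside : ∀ {n} (χ : Coloring n) x y → x + y ≤ n → mono χ x y ≡
    (if sameB (col χ x) (col χ y) then (if sameB (col χ y) (col χ (x + y)) then 1 else 0) else 0)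
  mono-inside {n} χ x y x+y≤n with x + y ≤? n
  ... | yes _    = refl
  ... | no x+y≰n = contradiction x+y≤n x+y≰n

  mono-zero : ∀ n (χ : Coloring n) i j → n ≤ suc (i + j) → mono χ (suc i) (suc j) ≡ 0
  mono-zero n χ i j n≤ with suc i + suc j ≤? n
  ... | yes i+j≤n = contradiction n≤ (ℕ.<⇒≱ (subst (_< n) (ℕ.+-suc i j) i+j≤n))
  ... | no _ = refl

open Counting

-- Lower bound: integer sums over intervals and triangles.

module LowerBound where

  open import Data.Integer using (ℤ; +_; -[1+_]; _+_; _*_; _-_; -_; _≤_; +≤+)
  open import Data.Integer.Properties
    using (+-assoc; +-comm; +-identityˡ; *-assoc; *-comm; *-zeroʳ; *-distribˡ-+; +-mono-≤;
           pos-+; pos-*; drop‿+≤+; *-cancelˡ-≤-pos; 0≤i-j⇒j≤i)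
  open import Data.Integer.Tactic.RingSolver using (solve-∀)

  sgn : Bool → ℤ
  sgn true = + 1
  sgn false = - + 1

  sgn² : ∀ s → sgn s * sgn s ≡ + 1
  sgn² true  = refl
  sgn² false = refl

  sgn-not : ∀ s → sgn (not s) ≡ - sgn s
  sgn-not true  = refl
  sgn-not false = refl

  centre : Maybe Bool → ℤ
  centre = maybe sgn (+ 0)

  ∑ℤ : ℕ → (ℕ → ℤ) → ℤ
  ∑ℤ zero    f = + 0
  ∑ℤ (suc n) f = f 0 + ∑ℤ n (f ∘ suc)

  -- The sum of g over 0-based pairs standing for x = i + 1, y = j + 1 with x + y ≤ n.
  △ : ℕ → (ℕ → ℕ → ℤ) → ℤ
  △ zero    g = + 0
  △ (suc n) g = ∑ℤ n (g 0) + △ n (g ∘ suc)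

  ∑-cast : ∀ n f → + ∑ n f ≡ ∑ℤ n (λ i → + f i)
  ∑-cast zero    f = refl
  ∑-cast (suc n) f = trans (pos-+ (f 0) _) (cong (_+_ (+ f 0)) (∑-cast n (f ∘ suc)))

  ∑ℤ-zero : ∀ n f → (∀ i → f i ≡ + 0) → ∑ℤ n f ≡ + 0
  ∑ℤ-zero zero    f f≡0 = refl
  ∑ℤ-zero (suc n) f f≡0 = cong₂ _+_ (f≡0 0) (∑ℤ-zero n (f ∘ suc) (f≡0 ∘ suc))

  ∑ℤ-truncate : ∀ {m n} f → m ℕ.≤ n → (∀ i → m ℕ.≤ i → f i ≡ + 0) → ∑ℤ n f ≡ ∑ℤ m f
  ∑ℤ-truncate {n = n} f z≤n       f≡0 = ∑ℤ-zero n f (λ i → f≡0 i z≤n)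
  ∑ℤ-truncate         f (s≤s m≤n) f≡0 =
    cong (_+_ (f 0)) (∑ℤ-truncate (f ∘ suc) m≤n (λ i m≤i → f≡0 (suc i) (s≤s m≤i)))

  -- The row length `N` is kept apart from `n` because the induction shortens only the outer sum.
  -- Each row is then truncated to its part inside the triangle, outside of which `g` vanishes.
  ∑∑-△ : ∀ n N (g : ℕ → ℕ → ℕ) → n ℕ.≤ suc N → (∀ i j → n ℕ.≤ suc (i ℕ.+ j) → g i j ≡ 0) →
    + ∑ n (λ i → ∑ N (g i)) ≡ △ n (λ i j → + g i j)
  ∑∑-△ zero    N g n≤N g≡0 = refl
  ∑∑-△ (suc n) N g (s≤s n≤N) g≡0 = cong₂ _+_
    (trans (∑-cast N (g 0))
           (∑ℤ-truncate _ n≤N (λ j n≤j → cong +_ (g≡0 0 j (s≤s n≤j)))))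
    (∑∑-△ n N (g ∘ suc) (ℕ.m≤n⇒m≤1+n n≤N) (λ i j n≤ → g≡0 (suc i) j (s≤s n≤)))

  ∑ℤ-cong : ∀ n {f g} → (∀ i → i ℕ.< n → f i ≡ g i) → ∑ℤ n f ≡ ∑ℤ n g
  ∑ℤ-cong zero    f≡g = refl
  ∑ℤ-cong (suc n) f≡g = cong₂ _+_ (f≡g 0 (s≤s z≤n)) (∑ℤ-cong n (λ i i<n → f≡g (suc i) (s≤s i<n)))

  △-cong : ∀ n {f g} → (∀ i j → suc (i ℕ.+ j) ℕ.< n → f i j ≡ g i j) → △ n f ≡ △ n g
  △-cong zero    f≡g = refl
  △-cong (suc n) f≡g = cong₂ _+_ (∑ℤ-cong n (λ j j<n → f≡g 0 j (s≤s j<n)))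
                                 (△-cong n (λ i j ij<n → f≡g (suc i) j (s≤s ij<n)))

  medial : ∀ a b c d → (a + b) + (c + d) ≡ (a + c) + (b + d)
  medial = solve-∀

  ∑ℤ-+ : ∀ n f g → ∑ℤ n (λ i → f i + g i) ≡ ∑ℤ n f + ∑ℤ n g
  ∑ℤ-+ zero    f g = refl
  ∑ℤ-+ (suc n) f g = trans (cong (_+_ (f 0 + g 0)) (∑ℤ-+ n (f ∘ suc) (g ∘ suc)))
                           (medial (f 0) (g 0) _ _)

  ∑ℤ-* : ∀ n a f → ∑ℤ n (λ i → a * f i) ≡ a * ∑ℤ n f
  ∑ℤ-* zero    a f = sym (*-zeroʳ a)
  ∑ℤ-* (suc n) a f = trans (cong (_+_ (a * f 0)) (∑ℤ-* n a (f ∘ suc)))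
                           (sym (*-distribˡ-+ a (f 0) _))

  ∑ℤ-snoc : ∀ n f → ∑ℤ (suc n) f ≡ ∑ℤ n f + f n
  ∑ℤ-snoc zero    f = +-comm (f 0) (+ 0)
  ∑ℤ-snoc (suc n) f = trans (cong (_+_ (f 0)) (∑ℤ-snoc n (f ∘ suc))) (sym (+-assoc (f 0) _ _))

  △-+ : ∀ n f g → △ n (λ i j → f i j + g i j) ≡ △ n f + △ n g
  △-+ zero    f g = refl
  △-+ (suc n) f g = trans (cong₂ _+_ (∑ℤ-+ n (f 0) (g 0)) (△-+ n (f ∘ suc) (g ∘ suc)))
                          (medial (∑ℤ n (f 0)) (∑ℤ n (g 0)) _ _)

  △-* : ∀ n a f → △ n (λ i j → a * f i j) ≡ a * △ n f
  △-* zero    a f = sym (*-zeroʳ a)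
  △-* (suc n) a f = trans (cong₂ _+_ (∑ℤ-* n a (f 0)) (△-* n a (f ∘ suc)))
                          (sym (*-distribˡ-+ a _ _))

  -- The definition of `△` splits off a row. Splitting off a column instead gives the symmetry of
  -- the triangle, and row and column together lead from n + 2 to n.
  △-column : ∀ n g → △ (suc n) g ≡ ∑ℤ n (λ i → g i 0) + △ n (λ i j → g i (suc j))
  △-column zero    g = refl
  △-column (suc n) g =
    trans (cong (_+_ (∑ℤ (suc n) (g 0))) (△-column n (g ∘ suc)))
          (exchange (g 0 0) (∑ℤ n (λ j → g 0 (suc j))) (∑ℤ n (λ i → g (suc i) 0)) _)
    where
    exchange : ∀ a b c d → a + b + (c + d) ≡ a + c + (b + d)
    exchange = solve-∀

  △-flip : ∀ n g → △ n (flip g) ≡ △ n g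
  △-flip zero    g = refl
  △-flip (suc n) g = trans (cong (_+_ (∑ℤ n (λ j → g j 0))) (△-flip n (λ i j → g i (suc j))))
                           (sym (△-column n g))

  ∑ℤ-one : ∀ n → ∑ℤ n (λ _ → + 1) ≡ + n
  ∑ℤ-one zero    = refl
  ∑ℤ-one (suc n) = cong (_+_ (+ 1)) (∑ℤ-one n)

  △-one : ∀ n → + 2 * △ n (λ _ _ → + 1) ≡ + n * + n - + n
  △-one zero    = refl
  △-one (suc n) = begin
    + 2 * (∑ℤ n (λ _ → + 1) + △ n (λ _ _ → + 1))  ≡⟨ *-distribˡ-+ (+ 2) (∑ℤ n _) _ ⟩
    + 2 * ∑ℤ n (λ _ → + 1) + + 2 * △ n (λ _ _ → + 1)
      ≡⟨ cong₂ (λ x y → + 2 * x + y) (∑ℤ-one n) (△-one n) ⟩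
    + 2 * + n + (+ n * + n - + n)                 ≡⟨ step (+ n) ⟩
    (+ 1 + + n) * (+ 1 + + n) - (+ 1 + + n)       ∎
    where
    open ≡-Reasoning
    step : ∀ k → + 2 * k + (k * k - k) ≡ (+ 1 + k) * (+ 1 + k) - (+ 1 + k)
    step = solve-∀

  -- Quadratic sums of signs.

  module Signs (κ : ℕ → Bool) where

    ε : ℕ → ℤ
    ε i = sgn (κ i)

  -- With z = x + y the sum runs over the pairs x < z.
  △-differences : ∀ n κ → let open Signs κ in
    + 2 * △ n (λ i j → ε i * ε (suc (i ℕ.+ j))) ≡ ∑ℤ n ε * ∑ℤ n ε - + n
  △-differences zero    κ = refl
  △-differences (suc n) κ = begin
    + 2 * (∑ℤ n (λ j → ε 0 * ε (suc j)) + △ n _)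
      ≡⟨ *-distribˡ-+ (+ 2) (∑ℤ n _) _ ⟩
    + 2 * ∑ℤ n (λ j → ε 0 * ε (suc j)) + + 2 * △ n _
      ≡⟨ cong₂ (λ x y → + 2 * x + y) (∑ℤ-* n (ε 0) (ε ∘ suc)) (△-differences n (κ ∘ suc)) ⟩
    + 2 * (ε 0 * S) + (S * S - + n)
      ≡⟨ step (ε 0) S (+ n) ⟩
    (ε 0 + S) * (ε 0 + S) - (ε 0 * ε 0 + + n)
      ≡⟨ cong (λ x → (ε 0 + S) * (ε 0 + S) - (x + + n)) (sgn² (κ 0)) ⟩
    (ε 0 + S) * (ε 0 + S) - (+ 1 + + n) ∎
    where
    open ≡-Reasoning
    open Signs κ
    S = ∑ℤ n (ε ∘ suc)
    step : ∀ a s k → + 2 * (a * s) + (s * s - k) ≡ (a + s) * (a + s) - (a * a + k)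
    step = solve-∀

  △ε : ℕ → (ℕ → Bool) → ℤ
  △ε n κ = △ n (λ i j → ε i * ε j) where open Signs κ

  -- Removing both 1 and n preserves the condition x + y ≤ n of the remaining pairs, since the
  -- indices drop by 1 and n by 2.
  △ε-peel : ∀ n κ → let open Signs κ in
    △ε (2 ℕ.+ n) κ ≡ + 2 * ε 0 * ∑ℤ n (ε ∘ suc) + + 1 + △ε n (κ ∘ suc)
  △ε-peel n κ = begin
    (ε 0 * ε 0 + ∑ℤ n (λ j → ε 0 * ε (suc j))) + △ (suc n) (λ i j → ε (suc i) * ε j)
      ≡⟨ cong₂ (λ x y → x + ∑ℤ n (λ j → ε 0 * ε (suc j)) + y) (sgn² (κ 0))
               (△-column n (λ i j → ε (suc i) * ε j)) ⟩
    (+ 1 + ∑ℤ n (λ j → ε 0 * ε (suc j))) + (∑ℤ n (λ i → ε (suc i) * ε 0) + T)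
      ≡⟨ cong₂ (λ x y → (+ 1 + x) + (y + T)) (∑ℤ-* n (ε 0) (ε ∘ suc))
               (trans (∑ℤ-cong n (λ i _ → *-comm (ε (suc i)) (ε 0))) (∑ℤ-* n (ε 0) (ε ∘ suc))) ⟩
    (+ 1 + ε 0 * S) + (ε 0 * S + T)
      ≡⟨ step (ε 0) S T ⟩
    + 2 * ε 0 * S + + 1 + T ∎
    where
    open ≡-Reasoning
    open Signs κ
    S = ∑ℤ n (ε ∘ suc)
    T = △ε n (κ ∘ suc)
    step : ∀ a s t → (+ 1 + a * s) + (a * s + t) ≡ + 2 * a * s + + 1 + t
    step = solve-∀

  -- The walk of a colouring and its area bound.

  record Walk (n : ℕ) (S T : ℤ) : Set where
    constructor walk
    field
      mid     : Maybe Bool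
      P Q H V : ℤ
    c = centre mid
    field
      size  : + n ≡ + 2 * (H + V) + c * c
      total : S ≡ + 2 * P + c
      -- Quantifying over the sign covers both P ≤ H and -P ≤ H. All estimates are stored as
      -- nonnegative differences, so that ring identities can transport them.
      ∣P∣≤H : ∀ s → + 0 ≤ H - sgn s * P
      ∣Q∣≤V : ∀ s → + 0 ≤ V - sgn s * Q
      bound : + 0 ≤ T - (+ 2 * (P + c) * (P + Q) - + 2 * H * V - H + V)

  0≤+ : ∀ {i j} → + 0 ≤ i → + 0 ≤ j → + 0 ≤ i + j
  0≤+ = +-mono-≤

  0≤* : ∀ {i j} → + 0 ≤ i → + 0 ≤ j → + 0 ≤ i * j
  0≤* {+ m} {+ n} _ _ = subst (+ 0 ≤_) (pos-* m n) (+≤+ z≤n)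

  0≤² : ∀ i → + 0 ≤ i * i
  0≤² (+ n)    = 0≤* {+ n} {+ n} (+≤+ z≤n) (+≤+ z≤n)
  0≤² -[1+ n ] = +≤+ z≤n

  -- The added term is 0 or 2. It is the change of H - sP when H grows by 1 and P by the sign t.
  0≤+1∓ : ∀ {i} s t → + 0 ≤ i → + 0 ≤ i + (+ 1 - sgn s * sgn t)
  0≤+1∓ true  true  0≤i = 0≤+ 0≤i (+≤+ z≤n)
  0≤+1∓ true  false 0≤i = 0≤+ 0≤i (+≤+ z≤n)
  0≤+1∓ false true  0≤i = 0≤+ 0≤i (+≤+ z≤n)
  0≤+1∓ false false 0≤i = 0≤+ 0≤i (+≤+ z≤n)

  shift : ∀ x s a b → x - s * a + (+ 1 - s * b) ≡ x + + 1 - s * (a + b)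
  shift = solve-∀

  straight : ∀ s {n S T} → Walk n S T →
    Walk (2 ℕ.+ n) (sgn s + (S + sgn s)) (+ 2 * sgn s * S + + 1 + T)
  straight s {T = T} (walk mid P Q H V size refl ∣P∣≤H ∣Q∣≤V bound) = record
    { mid = mid ; P = P + sgn s ; Q = Q ; H = H + + 1 ; V = V
    ; size  = trans (cong (_+_ (+ 2)) size) (size′ c H V)
    ; total = total′ c P (sgn s)
    ; ∣P∣≤H = λ t → subst (+ 0 ≤_) (shift H (sgn t) P (sgn s)) (0≤+1∓ t s (∣P∣≤H t))
    ; ∣Q∣≤V = ∣Q∣≤V
    -- The slack grows by 2 (V - pQ), nonnegative because |Q| ≤ V. The vanishing term 1 - p p is
    -- carried along so that `bound′` is an identity for arbitrary p.
    ; bound = subst (+ 0 ≤_) (bound′ c P Q H V T (sgn s))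
                (0≤+ bound (0≤* {+ 2} (+≤+ z≤n) (0≤+1∓ s s (∣Q∣≤V s))))
    }
    where
    c = centre mid
    size′ : ∀ c H V → + 2 + (+ 2 * (H + V) + c * c) ≡ + 2 * (H + + 1 + V) + c * c
    size′ = solve-∀
    total′ : ∀ c P p → p + (+ 2 * P + c + p) ≡ + 2 * (P + p) + c
    total′ = solve-∀
    bound′ : ∀ c P Q H V T p →
      T - (+ 2 * (P + c) * (P + Q) - + 2 * H * V - H + V) + + 2 * (V - p * Q + (+ 1 - p * p))
      ≡ + 2 * p * (+ 2 * P + c) + + 1 + T
        - (+ 2 * (P + p + c) * (P + p + Q) - + 2 * (H + + 1) * V - (H + + 1) + V)
    bound′ = solve-∀

  turn : ∀ s {n S T} → Walk n S T →
    Walk (2 ℕ.+ n) (sgn s + (S + sgn (not s))) (+ 2 * sgn s * S + + 1 + T)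
  turn s {T = T} (walk mid P Q H V size refl ∣P∣≤H ∣Q∣≤V bound) = record
    { mid = mid ; P = P ; Q = Q + sgn s ; H = H ; V = V + + 1
    ; size  = trans (cong (_+_ (+ 2)) size) (size′ c H V)
    ; total = trans (cong (λ x → sgn s + (+ 2 * P + c + x)) (sgn-not s)) (total′ c P (sgn s))
    ; ∣P∣≤H = ∣P∣≤H
    ; ∣Q∣≤V = λ t → subst (+ 0 ≤_) (shift V (sgn t) Q (sgn s)) (0≤+1∓ t s (∣Q∣≤V t))
    -- Here the slack grows by 2 (H + qP), so |P| ≤ H is applied with the opposite sign.
    ; bound = subst (+ 0 ≤_) (bound′ c P Q H V T (sgn s))
                (0≤+ bound (0≤* {+ 2} (+≤+ z≤n)
                  (subst (λ x → + 0 ≤ H - x * P) (sgn-not s) (∣P∣≤H (not s)))))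
    }
    where
    c = centre mid
    size′ : ∀ c H V → + 2 + (+ 2 * (H + V) + c * c) ≡ + 2 * (H + (V + + 1)) + c * c
    size′ = solve-∀
    total′ : ∀ c P q → q + (+ 2 * P + c + - q) ≡ + 2 * P + c
    total′ = solve-∀
    bound′ : ∀ c P Q H V T q →
      T - (+ 2 * (P + c) * (P + Q) - + 2 * H * V - H + V) + + 2 * (H - - q * P)
      ≡ + 2 * q * (+ 2 * P + c) + + 1 + T
        - (+ 2 * (P + c) * (P + (Q + q)) - + 2 * H * (V + + 1) - H + (V + + 1))
    bound′ = solve-∀

  -- The colours a and b belong to the new first and last elements. The last one affects the sum of
  -- signs only: it is too large to be a summand x or y, which gives the form found in `△ε-peel`.
  extend : ∀ a b {n S T} → Walk n S T →
    Walk (2 ℕ.+ n) (sgn a + (S + sgn b)) (+ 2 * sgn a * S + + 1 + T)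
  extend true  true  = straight true
  extend true  false = turn true
  extend false true  = turn false
  extend false false = straight false

  ∣0∣≤0 : ∀ s → + 0 ≤ + 0 - sgn s * + 0
  ∣0∣≤0 true  = +≤+ z≤n
  ∣0∣≤0 false = +≤+ z≤n

  colouring-walk : ∀ n κ → Walk n (∑ℤ n (Signs.ε κ)) (△ε n κ)
  colouring-walk 0 κ = walk nothing (+ 0) (+ 0) (+ 0) (+ 0) refl refl ∣0∣≤0 ∣0∣≤0 (+≤+ z≤n)
  colouring-walk 1 κ = walk (just (κ 0)) (+ 0) (+ 0) (+ 0) (+ 0)
    (sym (trans (+-identityˡ _) (sgn² (κ 0)))) (+-comm (sgn (κ 0)) (+ 0)) ∣0∣≤0 ∣0∣≤0
    (subst (+ 0 ≤_) (sym (base (sgn (κ 0)))) (+≤+ z≤n))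
    where
    base : ∀ c → + 0 - (+ 2 * (+ 0 + c) * (+ 0 + + 0) - + 2 * + 0 * + 0 - + 0 + + 0) ≡ + 0
    base = solve-∀
  colouring-walk (suc (suc n)) κ =
    subst₂ (Walk (2 ℕ.+ n))
      (cong (_+_ (ε 0)) (sym (∑ℤ-snoc n (ε ∘ suc))))
      (sym (△ε-peel n κ))
      (extend (κ 0) (κ (suc n)) (colouring-walk n (κ ∘ suc)))
    where open Signs κ

  -- Completing squares.

  -- If the sign s is chosen such that p = |P + c|, all summands on the left are nonnegative.
  certificate : ∀ s m (P Q H V T : ℤ) →
    let c = centre m
        n = + 2 * (H + V) + c * c
        S = + 2 * P + c
        p = + 0 - sgn s * (P + c)
    in (+ 3 * n - + 6 - + 11 * V) * (+ 3 * n - + 6 - + 11 * V)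
       + (+ 11 * ((+ 6 * p - + 3 * (c * c) - V) * (+ 6 * p - + 3 * (c * c) - V))
       + (p * (+ 132 * (V - sgn s * Q) + + 396 * (c * c + sgn s * c))
       + (+ 66 * (T - (+ 2 * (P + c) * (P + Q) - + 2 * H * V - H + V)) + + 60)))
     ≡ + 33 * (n * n - n + + 2 * (S * S - n) + + 2 * T) - + 24 * (n * n - + 4 * n - + 4)
  -- The identity relies on s² = 1 and c⁴ = c², so it becomes a polynomial identity only after s and
  -- c are fixed.
  certificate true  nothing      = solve-∀
  certificate true  (just true)  = solve-∀
  certificate true  (just false) = solve-∀
  certificate false nothing      = solve-∀
  certificate false (just true)  = solve-∀
  certificate false (just false) = solve-∀

  0≤c²+sc : ∀ s m → + 0 ≤ centre m * centre m + sgn s * centre m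
  0≤c²+sc true  nothing      = +≤+ z≤n
  0≤c²+sc true  (just true)  = +≤+ z≤n
  0≤c²+sc true  (just false) = +≤+ z≤n
  0≤c²+sc false nothing      = +≤+ z≤n
  0≤c²+sc false (just true)  = +≤+ z≤n
  0≤c²+sc false (just false) = +≤+ z≤n

  opposite-sign : ∀ i → Σ Bool λ s → + 0 ≤ + 0 - sgn s * i
  opposite-sign (+ n)    = false , subst (+ 0 ≤_) (neg-neg (+ n)) (+≤+ z≤n)
    where
    neg-neg : ∀ i → i ≡ + 0 - - + 1 * i
    neg-neg = solve-∀
  opposite-sign -[1+ n ] = true , +≤+ z≤n

  -- For the S and T of a colouring the factor after 33 is 8M, so the right side is 24 (11M - (n² -
  -- 4n - 4)). The squares of `certificate` vanish near V = 3n/11 and |P + c| = n/22, which are the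
  -- values of the block colouring up to rounding.
  walk-bound : ∀ {n S T} → Walk n S T →
    + 0 ≤ + 33 * (+ n * + n - + n + + 2 * (S * S - + n) + + 2 * T) - + 24 * (+ n * + n - + 4 * + n - + 4)
  walk-bound {n} {T = T} (walk mid P Q H V size refl ∣P∣≤H ∣Q∣≤V bound)
    with s , 0≤p ← opposite-sign (P + centre mid) =
    subst (λ x → + 0 ≤ + 33 * (x * x - x + + 2 * (S * S - x) + + 2 * T) - + 24 * (x * x - + 4 * x - + 4))
      (sym size) (subst (+ 0 ≤_) (certificate s mid P Q H V T)
      (0≤+ (0≤² (+ 3 * N - + 6 - + 11 * V))
      (0≤+ (0≤* {+ 11} (+≤+ z≤n) (0≤² (+ 6 * (+ 0 - sgn s * (P + c)) - + 3 * (c * c) - V)))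
      (0≤+ (0≤* 0≤p (0≤+ (0≤* {+ 132} (+≤+ z≤n) (∣Q∣≤V s))
                         (0≤* {+ 396} (+≤+ z≤n) (0≤c²+sc s mid))))
      (0≤+ (0≤* {+ 66} (+≤+ z≤n) bound) (+≤+ z≤n))))))
    where
    c = centre mid
    N = + 2 * (H + V) + c * c
    S = + 2 * P + c

  -- From monochromatic triples to sums of signs.

  sameB-signs : ∀ p q r →
    + 4 * + (if sameB p q then (if sameB q r then 1 else 0) else 0)
    ≡ + 1 + sgn q * sgn r + sgn p * sgn r + sgn p * sgn q
  -- The pairwise products of three signs sum to 3 if all agree and to -1 otherwise.
  sameB-signs true  true  true  = refl
  sameB-signs true  true  false = refl
  sameB-signs true  false true  = refl
  sameB-signs true  false false = refl
  sameB-signs false true  true  = refl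
  sameB-signs false true  false = refl
  sameB-signs false false true  = refl
  sameB-signs false false false = refl

  mono-signs : ∀ n (χ : Coloring n) i j → suc (i ℕ.+ j) ℕ.< n →
    + 4 * + mono χ (suc i) (suc j) ≡
    + 1 + sgn (col χ (suc j)) * sgn (col χ (suc (suc (i ℕ.+ j))))
      + sgn (col χ (suc i)) * sgn (col χ (suc (suc (i ℕ.+ j))))
      + sgn (col χ (suc i)) * sgn (col χ (suc j))
  mono-signs n χ i j ij<n rewrite sym (ℕ.+-suc i j) =
    trans (cong (λ x → + 4 * + x) (mono-inside χ (suc i) (suc j) ij<n))
          (sameB-signs (col χ (suc i)) (col χ (suc j)) (col χ (suc i ℕ.+ suc j)))

  -- A factor 4 of the 8 comes from `sameB-signs`, the remaining 2 clears the halves in `△-one` and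
  -- `△-differences`.
  Mcount-signs : ∀ n (χ : Coloring n) → let κ = λ i → col χ (suc i); S = ∑ℤ n (Signs.ε κ) in
    + 8 * + Mcount n χ ≡ + n * + n - + n + + 2 * (S * S - + n) + + 2 * △ε n κ
  Mcount-signs n χ = begin
    + 8 * + Mcount n χ
      ≡⟨ cong (λ x → + 8 * x) (trans (cong +_ (Mcount-∑ n χ))
           (∑∑-△ n n _ (ℕ.n≤1+n n) (mono-zero n χ))) ⟩
    + 8 * △ n (λ i j → + mono χ (suc i) (suc j))
      ≡⟨ *-assoc (+ 2) (+ 4) _ ⟩
    + 2 * (+ 4 * △ n (λ i j → + mono χ (suc i) (suc j)))
      ≡⟨ cong (λ x → + 2 * x) (trans (sym (△-* n (+ 4) _)) (△-cong n (mono-signs n χ))) ⟩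
    + 2 * △ n (λ i j → + 1 + yz i j + xz i j + xy i j)
      ≡⟨ cong (λ x → + 2 * x) (trans (△-+ n (λ i j → + 1 + yz i j + xz i j) xy)
           (cong (λ z → z + △ n xy) (trans (△-+ n (λ i j → + 1 + yz i j) xz)
             (cong (λ z → z + △ n xz) (△-+ n one yz))))) ⟩
    + 2 * (△ n one + △ n yz + △ n xz + △ n xy)
      -- Exchanging x and y identifies the sum over the pairs (y, z) with that over the pairs (x,
      -- z).
      ≡⟨ cong (λ y → + 2 * (△ n one + y + △ n xz + △ n xy))
           (trans (△-cong n (λ i j _ → cong (λ k → ε j * ε (suc k)) (ℕ.+-comm i j))) (△-flip n xz)) ⟩
    + 2 * (△ n one + △ n xz + △ n xz + △ n xy)
      ≡⟨ distribute (△ n one) (△ n xz) (△ n xy) ⟩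
    + 2 * △ n one + + 2 * (+ 2 * △ n xz) + + 2 * △ n xy
      ≡⟨ cong₂ (λ x y → x + + 2 * y + + 2 * △ n xy) (△-one n) (△-differences n κ) ⟩
    + n * + n - + n + + 2 * (∑ℤ n ε * ∑ℤ n ε - + n) + + 2 * △ε n κ ∎
    where
    open ≡-Reasoning
    κ : ℕ → Bool
    κ i = col χ (suc i)
    open Signs κ
    one xy xz yz : ℕ → ℕ → ℤ
    one i j = + 1
    xy i j = ε i * ε j
    xz i j = ε i * ε (suc (i ℕ.+ j))
    yz i j = ε j * ε (suc (i ℕ.+ j))
    distribute : ∀ a b d → + 2 * (a + b + b + d) ≡ + 2 * a + + 2 * (+ 2 * b) + + 2 * d
    distribute = solve-∀

  -- This is 11M ≥ n² - 4n - 4 without subtraction. The 10 = 6 + 4 is the largest remainder modulo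
  -- 11, which is exactly what rounding down absorbs.
  Mcount-lower : ∀ n (χ : Coloring n) → n ℕ.* n ℕ.+ 6 ℕ.≤ 4 ℕ.* n ℕ.+ (11 ℕ.* Mcount n χ ℕ.+ 10)
  Mcount-lower n χ = drop‿+≤+ (subst₂ _≤_
      (sym (trans (pos-+ (n ℕ.* n) 6) (cong (λ z → z + + 6) (pos-* n n))))
      (sym (trans (pos-+ (4 ℕ.* n) _) (cong₂ _+_ (pos-* 4 n)
        (trans (pos-+ (11 ℕ.* M) 10) (cong (λ z → z + + 10) (pos-* 11 M))))))
      (*-cancelˡ-≤-pos _ _ (+ 24) (0≤i-j⇒j≤i (subst (+ 0 ≤_) eq
         (walk-bound (colouring-walk n (λ i → col χ (suc i))))))))
    where
    M = Mcount n χ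
    rearrange : ∀ n M → + 33 * (+ 8 * M) - + 24 * (n * n - + 4 * n - + 4)
      ≡ + 24 * (+ 4 * n + (+ 11 * M + + 10)) - + 24 * (n * n + + 6)
    rearrange = solve-∀
    eq = trans (cong (λ x → + 33 * x - + 24 * (+ n * + n - + 4 * + n - + 4)) (sym (Mcount-signs n χ)))
               (rearrange (+ n) (+ M))

-- Upper bound: counting lattice points in triangles.

open LowerBound using (Mcount-lower)
open import Data.Bool using (T)
open import Data.Nat using (_+_; _*_; _∸_; _≤_; _<_; _<?_; _<ᵇ_)

∑-mono : ∀ n {f g} → (∀ i → f i ≤ g i) → ∑ n f ≤ ∑ n g
∑-mono zero    f≤g = z≤n
∑-mono (suc n) f≤g = ℕ.+-mono-≤ (f≤g 0) (∑-mono n (f≤g ∘ suc))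

∑-+ : ∀ n f g → ∑ n (λ i → f i + g i) ≤ ∑ n f + ∑ n g
∑-+ zero    f g = z≤n
∑-+ (suc n) f g = ℕ.≤-trans (ℕ.+-monoʳ-≤ (f 0 + g 0) (∑-+ n (f ∘ suc) (g ∘ suc)))
                            (ℕ.≤-reflexive (medial (f 0) (g 0) _ _))
  where
  medial : ∀ a b c d → (a + b) + (c + d) ≡ (a + c) + (b + d)
  medial = ℕ.solve-∀

∑-zero : ∀ n → ∑ n (λ _ → 0) ≡ 0
∑-zero zero    = refl
∑-zero (suc n) = ∑-zero n

∑∑ : ℕ → (ℕ → ℕ → ℕ) → ℕ
∑∑ n f = ∑ n λ i → ∑ n (f i)

∑∑-+ : ∀ n f g → ∑∑ n (λ i j → f i j + g i j) ≤ ∑∑ n f + ∑∑ n g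
∑∑-+ n f g = ℕ.≤-trans (∑-mono n (λ i → ∑-+ n (f i) (g i))) (∑-+ n _ _)

-- The value is e (e - 1) / 2, the number of pairs x, y ≥ 1 with x + y ≤ e.
triangle : ℕ → ℕ
triangle zero    = 0
triangle (suc e) = e + triangle e

-- The indicator of s ≤ i, t ≤ j, i + j + 2 ≤ s + t + e.
corner : ℕ → ℕ → ℕ → ℕ → ℕ → ℕ
corner zero    zero    e i       j       = if (i + suc j) <ᵇ e then 1 else 0
corner zero    (suc t) e i       zero    = 0
corner zero    (suc t) e i       (suc j) = corner zero t e i j
corner (suc s) t       e zero    j       = 0
corner (suc s) t       e (suc i) j       = corner s t e i j

corner-hit : ∀ {s t e i j} → s ≤ i → t ≤ j → i + suc j < s + t + e → 1 ≤ corner s t e i j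
corner-hit {e = e} {i} {j} z≤n z≤n ij<e with (i + suc j) <ᵇ e in eq
... | true  = s≤s z≤n
... | false = contradiction (subst T eq (ℕ.<⇒<ᵇ ij<e)) λ ()
corner-hit {t = suc t} {e} {i} {suc j} z≤n (s≤s t≤j) ij< =
  corner-hit {e = e} (z≤n {i}) t≤j (ℕ.s≤s⁻¹ (subst (_< suc t + e) (ℕ.+-suc i (suc j)) ij<))
corner-hit (s≤s s≤i) t≤j (s≤s ij<) = corner-hit s≤i t≤j ij<

∑-initial : ∀ n e → ∑ n (λ j → if j <ᵇ e then 1 else 0) ≤ e
∑-initial n       zero    = ℕ.≤-reflexive (∑-zero n)
∑-initial zero    (suc e) = z≤n
∑-initial (suc n) (suc e) = s≤s (∑-initial n e)

-- Moving the corner to the origin only discards zero rows and columns. There the first row has at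
-- most e - 1 hits and the remaining rows form the corner of side e - 1. Equality can fail because
-- the n by m window may cut the triangle.
∑-corner : ∀ n m s t e → ∑ n (λ i → ∑ m (corner s t e i)) ≤ triangle e
∑-corner zero    m s       t       e       = z≤n
∑-corner (suc n) m (suc s) t       e       =
  subst (λ x → x + ∑ n (λ i → ∑ m (corner s t e i)) ≤ triangle e) (sym (∑-zero m))
        (∑-corner n m s t e)
∑-corner (suc n) zero    zero (suc t) e = ∑-corner n zero zero t e
∑-corner (suc n) (suc m) zero (suc t) e = ∑-corner (suc n) m zero t e
∑-corner (suc n) m zero zero zero =
  subst (λ x → x + ∑ n (λ i → ∑ m (corner 0 0 0 i)) ≤ 0) (sym (∑-zero m))
        (∑-corner n m zero zero zero)
∑-corner (suc n) m zero zero (suc e) =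
  ℕ.+-mono-≤ (∑-initial m e) (∑-corner n m zero zero e)

-- The three-block colouring.

module Blocks (a c d : ℕ) where

  -- The blocks have lengths a, a + d and c. Since the middle block begins after a and ends at 2a +
  -- d, its pairs with x + y ≤ b fill a triangle of side d.
  b n : ℕ
  b = a + a + d
  n = b + c

  -- Indexing by the colour makes `sameB` compute as soon as zones are matched.
  data Zone (i : ℕ) : Bool → Set where
    low    : i < a → Zone i true
    middle : a ≤ i → i < b → Zone i false
    high   : b ≤ i → Zone i true

  classify : ∀ i → Σ Bool (Zone i)
  classify i with i <? a | i <? b
  ... | yes i<a | _       = true , low i<a
  ... | no  i≮a | yes i<b = false , middle (ℕ.≮⇒≥ i≮a) i<b
  ... | no  i≮a | no  i≮b = true , high (ℕ.≮⇒≥ i≮b)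

  κ : ℕ → Bool
  κ = proj₁ ∘ classify

  zone : ∀ i → Zone i (κ i)
  zone = proj₂ ∘ classify

  χ : Coloring n
  χ = tabulate (κ ∘ toℕ)

  col-χ : ∀ i → i < n → col χ (suc i) ≡ κ i
  col-χ i i<n with suc i ℕ.≤? n
  ... | yes p  = trans (lookup∘tabulate (κ ∘ toℕ) (fromℕ< p)) (cong κ (toℕ-fromℕ< p))
  ... | no i≮n = contradiction i<n i≮n

  -- The triangles contain the pairs with, respectively, x + y in the first block, y in the third,
  -- x in the third, and x, y, x + y in the middle one.
  cover : ℕ → ℕ → ℕ
  cover i j = corner 0 0 a i j + (corner 0 b c i j + (corner b 0 c i j + corner a a d i j))

  cover₁ : ∀ i j → 1 ≤ corner 0 0 a i j → 1 ≤ cover i j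
  cover₁ i j p = ℕ.≤-trans p (ℕ.m≤m+n _ _)

  cover₂ : ∀ i j → 1 ≤ corner 0 b c i j → 1 ≤ cover i j
  cover₂ i j p = ℕ.≤-trans p (ℕ.≤-trans (ℕ.m≤m+n _ _) (ℕ.m≤n+m _ (corner 0 0 a i j)))

  cover₃ : ∀ i j → 1 ≤ corner b 0 c i j → 1 ≤ cover i j
  cover₃ i j p = ℕ.≤-trans p (ℕ.≤-trans (ℕ.m≤m+n _ _)
    (ℕ.≤-trans (ℕ.m≤n+m _ (corner 0 b c i j)) (ℕ.m≤n+m _ (corner 0 0 a i j))))

  cover₄ : ∀ i j → 1 ≤ corner a a d i j → 1 ≤ cover i j
  cover₄ i j p = ℕ.≤-trans p (ℕ.≤-trans (ℕ.m≤n+m _ (corner b 0 c i j))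
    (ℕ.≤-trans (ℕ.m≤n+m _ (corner 0 b c i j)) (ℕ.m≤n+m _ (corner 0 0 a i j))))

  hit₃ : ∀ {i j} → b ≤ i → i + suc j < n → 1 ≤ corner b 0 c i j
  hit₃ {i} {j} b≤i z<n =
    corner-hit b≤i z≤n (subst (λ x → i + suc j < x + c) (sym (ℕ.+-identityʳ b)) z<n)

  indicator≤1 : ∀ {z r} → Zone z r → (if sameB true r then 1 else 0) ≤ 1
  indicator≤1 (low _)      = ℕ.≤-refl
  indicator≤1 (middle _ _) = z≤n
  indicator≤1 (high _)     = ℕ.≤-refl

  covered : ∀ {p q r} i j → i + suc j < n → Zone i p → Zone j q → Zone (i + suc j) r →
    (if sameB p q then (if sameB q r then 1 else 0) else 0) ≤ cover i j
  covered i j z<n (low _)        (low _)        (low z<a)      = cover₁ i j (corner-hit z≤n z≤n z<a)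
  -- The only monochromatic pattern outside the four triangles: two elements of the first block have
  -- sum at most 2a ≤ b and cannot reach the third.
  covered i j z<n (low i<a)      (low j<a)      (high b≤z)     =
    contradiction (ℕ.≤-trans (ℕ.m≤m+n (a + a) d) b≤z) (ℕ.<⇒≱ (ℕ.+-mono-<-≤ i<a j<a))
  covered i j z<n (middle a≤i _) (middle a≤j _) (middle _ z<b) = cover₄ i j (corner-hit a≤i a≤j z<b)
  covered i j z<n (low _)        (middle _ _)   _              = z≤n
  covered i j z<n (middle _ _)   (low _)        _              = z≤n
  covered i j z<n (middle _ _)   (high _)       _              = z≤n
  covered i j z<n (high _)       (middle _ _)   _              = z≤n
  covered i j z<n (low _)        (low _)        (middle _ _)   = z≤n
  covered i j z<n (middle _ _)   (middle _ _)   (low _)        = z≤n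
  covered i j z<n (middle _ _)   (middle _ _)   (high _)       = z≤n
  covered i j z<n (low _)        (high b≤j)     zone-z         =
    ℕ.≤-trans (indicator≤1 zone-z) (cover₂ i j (corner-hit z≤n b≤j z<n))
  covered i j z<n (high b≤i)     (low _)        zone-z         =
    ℕ.≤-trans (indicator≤1 zone-z) (cover₃ i j (hit₃ b≤i z<n))
  covered i j z<n (high b≤i)     (high _)       zone-z         =
    ℕ.≤-trans (indicator≤1 zone-z) (cover₃ i j (hit₃ b≤i z<n))

  mono-covered : ∀ i j → mono χ (suc i) (suc j) ≤ cover i j
  mono-covered i j with ℕ.<-≤-connex (i + suc j) n
  ... | inj₂ n≤z = subst (_≤ cover i j)
    (sym (mono-zero n χ i j (subst (n ≤_) (ℕ.+-suc i j) n≤z))) z≤n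
  ... | inj₁ z<n = ℕ.≤-trans (ℕ.≤-reflexive (trans (mono-inside χ (suc i) (suc j) z<n) colours))
                            (covered i j z<n (zone i) (zone j) (zone (i + suc j)))
    where
    colours : (if sameB (col χ (suc i)) (col χ (suc j))
               then (if sameB (col χ (suc j)) (col χ (suc (i + suc j))) then 1 else 0) else 0)
            ≡ (if sameB (κ i) (κ j) then (if sameB (κ j) (κ (i + suc j)) then 1 else 0) else 0)
    colours rewrite col-χ i (ℕ.≤-trans (ℕ.m≤m+n (suc i) (suc j)) z<n)
                  | col-χ j (ℕ.≤-trans (ℕ.m≤n+m (suc j) (suc i)) z<n)
                  | col-χ (i + suc j) z<n = refl

  Mcount-blocks : Mcount n χ ≤ triangle a + (triangle c + (triangle c + triangle d))
  Mcount-blocks = begin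
    Mcount n χ                                         ≡⟨ Mcount-∑ n χ ⟩
    ∑∑ n (λ i j → mono χ (suc i) (suc j))              ≤⟨ ∑-mono n (λ i → ∑-mono n (mono-covered i)) ⟩
    ∑∑ n cover                                         ≤⟨ split ⟩
    ∑∑ n (corner 0 0 a) + (∑∑ n (corner 0 b c) + (∑∑ n (corner b 0 c) + ∑∑ n (corner a a d)))
      ≤⟨ ℕ.+-mono-≤ (∑-corner n n 0 0 a) (ℕ.+-mono-≤ (∑-corner n n 0 b c)
           (ℕ.+-mono-≤ (∑-corner n n b 0 c) (∑-corner n n a a d))) ⟩
    triangle a + (triangle c + (triangle c + triangle d)) ∎
    where
    open ℕ.≤-Reasoning
    split = ℕ.≤-trans (∑∑-+ n (corner 0 0 a) _) (ℕ.+-monoʳ-≤ (∑∑ n (corner 0 0 a))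
           (ℕ.≤-trans (∑∑-+ n (corner 0 b c) _) (ℕ.+-monoʳ-≤ (∑∑ n (corner 0 b c))
             (∑∑-+ n (corner b 0 c) (corner a a d)))))

-- Triangular numbers and optimal block lengths.

triangle-+ : ∀ m n → triangle (m + n) ≡ triangle m + triangle n + m * n
triangle-+ zero    n = sym (ℕ.+-identityʳ (triangle n))
triangle-+ (suc m) n = trans (cong (m + n +_) (triangle-+ m n)) (step m n (triangle m) (triangle n))
  where
  step : ∀ m n s t → m + n + (s + t + m * n) ≡ m + s + t + suc m * n
  step = ℕ.solve-∀

square-triangle : ∀ n → n * n ≡ 2 * triangle n + n
square-triangle zero    = refl
square-triangle (suc n) = trans (expand n) (trans (cong (λ x → suc (x + 2 * n)) (square-triangle n))
                                                  (collect n (triangle n)))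
  where
  expand : ∀ n → suc n * suc n ≡ suc (n * n + 2 * n)
  expand = ℕ.solve-∀
  collect : ∀ n t → suc (2 * t + n + 2 * n) ≡ 2 * (n + t) + suc n
  collect = ℕ.solve-∀

triangle-2* : ∀ k → triangle (2 * k) ≡ 4 * triangle k + k
triangle-2* k = begin
  triangle (k + (k + 0))                ≡⟨ cong (λ x → triangle (k + x)) (ℕ.+-identityʳ k) ⟩
  triangle (k + k)                        ≡⟨ triangle-+ k k ⟩
  triangle k + triangle k + k * k     ≡⟨ cong (triangle k + triangle k +_) (square-triangle k) ⟩
  triangle k + triangle k + (2 * triangle k + k) ≡⟨ step k (triangle k) ⟩
  4 * triangle k + k                    ∎
  where
  open ≡-Reasoning
  step : ∀ k t → t + t + (2 * t + k) ≡ 4 * t + k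
  step = ℕ.solve-∀

blocks-value : ℕ → ℕ → ℕ → ℕ
blocks-value a c d = triangle a + (triangle c + (triangle c + triangle d))

-- A subtraction-free form of the claim that the value is at most (n² - 4n + 6) / 11.
Within : ℕ → ℕ → ℕ → Set
Within a c d = let n = a + a + d + c in 11 * blocks-value a c d + 4 * n ≤ n * n + 6

-- Both sides grow by the same amount, so a good shape for n is a good shape for n + 11 k.
Within-+ : ∀ k α γ δ → Within α γ δ → Within (2 * (2 * k) + α) (k + γ) (2 * k + δ)
Within-+ k α γ δ w
  rewrite triangle-+ (2 * (2 * k)) α | triangle-+ k γ | triangle-+ (2 * k) δ
        | triangle-2* (2 * k) | triangle-2* k = begin
  _ ≡⟨ left k (triangle k) α γ δ (triangle α) (triangle γ) (triangle δ) ⟩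
  X + (11 * blocks-value α γ δ + 4 * r) ≤⟨ ℕ.+-monoʳ-≤ X w ⟩
  X + (r * r + 6) ≡⟨ cong (λ x → 121 * x + 22 * k * r + (r * r + 6)) (sym (square-triangle k)) ⟩
  121 * (k * k) + 22 * k * r + (r * r + 6) ≡⟨ right k α γ δ ⟩
  _ ∎
  where
  open ℕ.≤-Reasoning
  r = α + α + δ + γ
  -- The common growth (11k + r)² - r² of both sides, with k² expressed through `triangle k`.
  X = 121 * (2 * triangle k + k) + 22 * k * r
  left : ∀ k t α γ δ tα tγ tδ → let r = α + α + δ + γ
                                    a = 2 * (2 * k) + α in
    11 * (4 * (4 * t + k) + 2 * k + tα + 2 * (2 * k) * α
      + (t + tγ + k * γ + (t + tγ + k * γ
      + (4 * t + k + tδ + 2 * k * δ))))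
      + 4 * (a + a + (2 * k + δ) + (k + γ))
    ≡ 121 * (2 * t + k) + 22 * k * r + (11 * (tα + (tγ + (tγ + tδ))) + 4 * r)
  left = ℕ.solve-∀
  right : ∀ k α γ δ → let r = α + α + δ + γ
                          a = 2 * (2 * k) + α
                          n = a + a + (2 * k + δ) + (k + γ) in
    121 * (k * k) + 22 * k * r + (r * r + 6) ≡ n * n + 6
  right = ℕ.solve-∀

record Shape (n : ℕ) : Set where
  constructor shape
  field
    a c d  : ℕ
    total  : n ≡ a + a + d + c
    within : Within a c d

-- The ideal ratio a : c : d = 4 : 1 : 2 is exact only for multiples of 11. For each remainder a
-- nearby integer shape is given, and evaluation confirms that it stays within the bound.
remainder-shape : ∀ r → r < 11 → Shape r
remainder-shape 0  _ = shape 0 0 0 refl (ℕ.≤ᵇ⇒≤ _ _ _)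
remainder-shape 1  _ = shape 0 0 1 refl (ℕ.≤ᵇ⇒≤ _ _ _)
remainder-shape 2  _ = shape 1 0 0 refl (ℕ.≤ᵇ⇒≤ _ _ _)
remainder-shape 3  _ = shape 1 0 1 refl (ℕ.≤ᵇ⇒≤ _ _ _)
remainder-shape 4  _ = shape 1 1 1 refl (ℕ.≤ᵇ⇒≤ _ _ _)
remainder-shape 5  _ = shape 1 1 2 refl (ℕ.≤ᵇ⇒≤ _ _ _)
remainder-shape 6  _ = shape 2 1 1 refl (ℕ.≤ᵇ⇒≤ _ _ _)
remainder-shape 7  _ = shape 2 1 2 refl (ℕ.≤ᵇ⇒≤ _ _ _)
remainder-shape 8  _ = shape 3 1 1 refl (ℕ.≤ᵇ⇒≤ _ _ _)
remainder-shape 9  _ = shape 3 1 2 refl (ℕ.≤ᵇ⇒≤ _ _ _)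
remainder-shape 10 _ = shape 3 1 3 refl (ℕ.≤ᵇ⇒≤ _ _ _)
remainder-shape (suc (suc (suc (suc (suc (suc (suc (suc (suc (suc (suc r)))))))))))
  (s≤s (s≤s (s≤s (s≤s (s≤s (s≤s (s≤s (s≤s (s≤s (s≤s (s≤s ())))))))))))

optimal-shape : ∀ n → Shape n
optimal-shape n with n / 11 | m≡m%n+[m/n]*n n 11 | remainder-shape (n % 11) (m%n<n n 11)
... | k | n≡ | shape α γ δ total w = shape (2 * (2 * k) + α) (k + γ) (2 * k + δ)
  (trans n≡ (trans (cong (_+ k * 11) total) (collect k α γ δ))) (Within-+ k α γ δ w)
  where
  collect : ∀ k α γ δ → α + α + δ + γ + k * 11 ≡
    (2 * (2 * k) + α) + (2 * (2 * k) + α) + (2 * k + δ) + (k + γ)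
  collect = ℕ.solve-∀

-- The two bounds combined.

minimum : ℕ → ℕ
-- The subtraction is never truncated, since n² - 4n + 6 = (n - 2)² + 2.
minimum n = (n * n + 6 ∸ 4 * n) / 11

minimum-≤ : ∀ n (χ : Coloring n) → minimum n ≤ Mcount n χ
minimum-≤ n χ = ℕ.s≤s⁻¹ (m<n*o⇒m/o<n (ℕ.≤-trans
  (s≤s (ℕ.m≤n+o⇒m∸n≤o (n * n + 6) (4 * n) (Mcount-lower n χ)))
  (ℕ.≤-reflexive (step (Mcount n χ)))))
  where
  step : ∀ m → suc (11 * m + 10) ≡ suc m * 11
  step = ℕ.solve-∀

-- An inequality suffices, because `minimum-≤` applied to the same colouring turns it into equality.
minimum-attained : ∀ n → Σ (Coloring n) λ χ → Mcount n χ ≤ minimum n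
minimum-attained n with shape a c d refl w ← optimal-shape n = χ , (begin
  Mcount n χ                     ≤⟨ Mcount-blocks ⟩
  blocks-value a c d             ≡⟨ m*n/n≡m (blocks-value a c d) 11 ⟨
  blocks-value a c d * 11 / 11   ≤⟨ /-monoˡ-≤ 11 (ℕ.m+n≤o⇒m≤o∸n (blocks-value a c d * 11) {4 * n}
    (subst (λ x → x + 4 * n ≤ n * n + 6) (ℕ.*-comm 11 (blocks-value a c d)) w)) ⟩
  minimum n                      ∎)
  where
  open ℕ.≤-Reasoning
  open Blocks a c d using (χ; Mcount-blocks)

theorem1 : (n : ℕ) → 1 ≤ n → IsMinM n ((n * n + 6 ∸ 4 * n) / 11)
theorem1 n _ with χ , M≤ ← minimum-attained n =
  (χ , ℕ.≤-antisym M≤ (minimum-≤ n χ)) , minimum-≤ n
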